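{- Let a $(V)$ pair consist of a connecting cell and a domino cell sharing a column. If every non-leaf of the domino cell lies, in position, between two consecutive skew components of the connecting cell, then the pair contains no occurrence of $1324$. The leaves of the domino cell may be placed arbitrarily.
   Context: A $(V)$ pair is a permutation whose points are partitioned into an upper cell and a lower cell, every point of the upper cell having larger value than every point of the lower cell (positions of the two cells interleave freely), where the upper cell avoids $213$ and the lower cell avoids $132$. One of the two cells (either the upper or the lower) is designated the connecting cell and the other the domino cell. Leaves: the leaves of a cell avoiding $213$ (the upper cell) are its right-to-left maxima, i.e. the points with no later larger point in the same cell; the leaves of a cell avoiding $132$ (the lower cell) are its left-to-right minima, i.e. the points with no earlier smaller point in the same cell. Non-leaves are the remaining points. Every permutation is uniquely a skew sum $c_1\ominus\cdots\ominus c_r$ of skew indecomposables, its skew components, which occupy consecutive position intervals and consecutive value intervals with earlier components holding larger values. A point of the domino cell lies "between two consecutive skew components" of the connecting cell if no skew component of the connecting cell has points both to its left and to its right; the two exterior positions, before all components and after all components, are allowed. -}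

module Defs where

open import Data.Nat using (ℕ)
import Data.Nat as ℕ
open import Data.Fin using (Fin; _<_)
open import Data.Fin.Permutation using (Permutation′; _⟨$⟩ʳ_)
open import Data.Fin.Subset using (Subset; _∈_; _∪_; ∁; ⋃; Nonempty)
open import Data.List using (List)
open import Data.List.Relation.Unary.All using (All)
open import Data.List.Relation.Unary.AllPairs using (AllPairs)
import Data.List.Membership.Propositional as List
open import Data.Product using (_×_; ∃-syntax)
open import Data.Vec using (Vec; []; _∷_; lookup)
open import Function.Bundles using (_⇔_)
open import Relation.Binary.PropositionalEquality using (_≡_)
open import Relation.Nullary using (¬_)

-- The points of a permutation π of Fin n are identified with their positions
-- i : Fin n; the value of the point i is π ⟨$⟩ʳ i.  A set of points is a
-- Subset n, and stands for the pattern that those points form in π.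

module _ {n : ℕ} (π : Permutation′ n) where

  -- Patterns are given in one-line notation.
  record Occurrence {k : ℕ} (σ : Vec ℕ k) (S : Subset n) : Set where
    field
      point      : Fin k → Fin n
      inside     : ∀ a → point a ∈ S
      increasing : ∀ a b → a < b → point a < point b
      order-iso  : ∀ a b → lookup σ a ℕ.< lookup σ b
                         ⇔ π ⟨$⟩ʳ point a < π ⟨$⟩ʳ point b

  Avoids : ∀ {k} → Vec ℕ k → Subset n → Set
  Avoids σ S = ¬ Occurrence σ S

  -- Every point of A is to the left of, and larger than, every point of B;
  -- equivalently, the pattern of A ∪ B is the skew sum of those of A and B.
  SkewBefore : Subset n → Subset n → Set
  SkewBefore A B = ∀ i j → i ∈ A → j ∈ B → i < j × π ⟨$⟩ʳ j < π ⟨$⟩ʳ i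

  SkewDecomposable : Subset n → Set
  SkewDecomposable S =
    ∃[ A ] ∃[ B ] Nonempty A × Nonempty B × A ∪ B ≡ S × SkewBefore A B

  SkewIndecomposable : Subset n → Set
  SkewIndecomposable S = Nonempty S × ¬ SkewDecomposable S

  -- cs = [ c₁ , … , cᵣ ] expresses the pattern of S as c₁ ⊖ ⋯ ⊖ cᵣ.
  record SkewDecomposition (S : Subset n) (cs : List (Subset n)) : Set where
    field
      covers         : ⋃ cs ≡ S
      ordered        : AllPairs SkewBefore cs
      indecomposable : All SkewIndecomposable cs

  SkewComponent : Subset n → Subset n → Set
  SkewComponent S c = ∃[ cs ] SkewDecomposition S cs × c List.∈ cs

  BetweenSkewComponents : Subset n → Fin n → Set
  BetweenSkewComponents S i = ∀ c → SkewComponent S c →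
    ¬ ((∃[ j ] j ∈ c × j < i) × (∃[ k ] k ∈ c × i < k))

p213 p132 : Vec ℕ 3
p213 = 2 ∷ 1 ∷ 3 ∷ []
p132 = 1 ∷ 3 ∷ 2 ∷ []

p1324 : Vec ℕ 4
p1324 = 1 ∷ 3 ∷ 2 ∷ 4 ∷ []

data Cell : Set where
  upper lower : Cell

opposite : Cell → Cell
opposite upper = lower
opposite lower = upper

record VPair (n : ℕ) : Set where
  field
    perm        : Permutation′ n
    upperPoints : Subset n

  lowerPoints : Subset n
  lowerPoints = ∁ upperPoints

  field
    upper-above-lower : ∀ i j → i ∈ upperPoints → j ∈ lowerPoints →
                        perm ⟨$⟩ʳ j < perm ⟨$⟩ʳ i
    upper-avoids-213  : Avoids perm p213 upperPoints
    lower-avoids-132  : Avoids perm p132 lowerPoints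

  points : Cell → Subset n
  points upper = upperPoints
  points lower = lowerPoints

  Leaf : Cell → Fin n → Set
  Leaf upper i = i ∈ upperPoints ×
    ¬ (∃[ j ] j ∈ upperPoints × i < j × perm ⟨$⟩ʳ i < perm ⟨$⟩ʳ j)
  Leaf lower i = i ∈ lowerPoints ×
    ¬ (∃[ j ] j ∈ lowerPoints × j < i × perm ⟨$⟩ʳ j < perm ⟨$⟩ʳ i)

  NonLeaf : Cell → Fin n → Set
  NonLeaf x i = i ∈ points x × ¬ Leaf x i

{-# OPTIONS --safe #-}

-- In an occurrence of 1324 at positions a < b < c < d the avoidance conditions
-- on the two cells force a, c into the lower cell and b, d into the upper one.
-- Then b and c are non-leaves, because of d and a respectively.  Two points
-- that form an ascent lie in a common skew component, so neither can c fall
-- between skew components of the upper cell, as b < c < d, nor b between skew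
-- components of the lower cell, as a < b < c.

module Submission where

open import Defs
open import Data.Nat using (ℕ)
import Data.Nat as ℕ
open import Data.Nat.Properties using () renaming (_<?_ to _<ℕ?_)
open import Data.Bool.Properties using () renaming (_≟_ to _≟ᵇ_)
open import Data.Fin using (Fin; suc; inject₁; _<_)
open import Data.Fin.Patterns using (0F; 1F; 2F; 3F)
open import Data.Fin.Properties using (all?; _<?_; <-asym; <-irrefl; <-trans; toℕ-inject₁)
open import Data.Fin.Permutation using (Permutation′; _⟨$⟩ʳ_)
open import Data.Fin.Subset using (Subset; ⊤; _∈_; _∪_; ⋃; _⊂_)
open import Data.Fin.Subset.Induction using (⊂-wellFounded; Acc; acc)
open import Data.Fin.Subset.Properties
  using (_∈?_; nonempty?; anySubset?; Empty-unique; ∉⊥; x∈p∪q⁻; p⊆p∪q; q⊆p∪q;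
         x∉p⇒x∈∁p; x∈∁p⇒x∉p; ∪-identityʳ; ∪-identityˡ; ∪-assoc)
open import Data.List using (List; []; _∷_; _++_)
import Data.List.Membership.Propositional as List
open import Data.List.Relation.Unary.All as All using (All; []; _∷_)
import Data.List.Relation.Unary.All.Properties as All
open import Data.List.Relation.Unary.AllPairs using (AllPairs; []; _∷_)
import Data.List.Relation.Unary.AllPairs.Properties as AllPairs
open import Data.List.Relation.Unary.Any using (here; there)
open import Data.Product using (_×_; _,_; proj₁; proj₂; ∃-syntax; uncurry)
open import Data.Sum using (inj₁; inj₂)
open import Data.Vec using (Vec; lookup)
open import Data.Vec.Properties using (≡-dec)
open import Function.Base using (_∘_)
open import Function.Bundles using (_⇔_; mk⇔; module Equivalence)
open import Function.Construct.Composition using (_⇔-∘_)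
open import Relation.Binary.PropositionalEquality
  using (_≡_; refl; sym; trans; cong; subst₂)
open import Relation.Nullary using (¬_; Dec; yes; no; contradiction)
open import Relation.Nullary.Decidable using (_×-dec_; _→-dec_; from-yes; decidable-stable)

⋃-++ : ∀ {n} (cs ds : List (Subset n)) → ⋃ (cs ++ ds) ≡ ⋃ cs ∪ ⋃ ds
⋃-++ []       ds = sym (∪-identityˡ (⋃ ds))
⋃-++ (c ∷ cs) ds = trans (cong (c ∪_) (⋃-++ cs ds)) (sym (∪-assoc c (⋃ cs) (⋃ ds)))

module _ {n : ℕ} (π : Permutation′ n) where

  -- Exhaustive search over pairs of subsets; it lets the recursion in `skewDecomposition-exists`
  -- branch constructively.
  skewDecomposable? : ∀ S → Dec (SkewDecomposable π S)
  skewDecomposable? S = anySubset? λ A → anySubset? λ B →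
    nonempty? A ×-dec nonempty? B ×-dec ≡-dec _≟ᵇ_ (A ∪ B) S ×-dec
    (all? λ i → all? λ j → (i ∈? A) →-dec ((j ∈? B) →-dec
      (i <? j ×-dec (π ⟨$⟩ʳ j) <? (π ⟨$⟩ʳ i))))

  skewBefore-disjoint : ∀ {A B i} → SkewBefore π A B → i ∈ A → ¬ i ∈ B
  skewBefore-disjoint A≻B i∈A i∈B = <-irrefl refl (proj₁ (A≻B _ _ i∈A i∈B))

  skewBefore-⋃ : ∀ {A} cs → All (SkewBefore π A) cs → SkewBefore π A (⋃ cs)
  skewBefore-⋃ []       []           i j i∈A j∈⊥ = contradiction j∈⊥ ∉⊥
  skewBefore-⋃ (c ∷ cs) (A≻c ∷ A≻cs) i j i∈A j∈∪ with x∈p∪q⁻ c (⋃ cs) j∈∪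
  ... | inj₁ j∈c  = A≻c i j i∈A j∈c
  ... | inj₂ j∈cs = skewBefore-⋃ cs A≻cs i j i∈A j∈cs

  -- Supplies the cross pairs when the parts of two decompositions are concatenated.
  skewBefore-⋃⁻ : ∀ cs ds → SkewBefore π (⋃ cs) (⋃ ds) →
                  All (λ c → All (SkewBefore π c) ds) cs
  skewBefore-⋃⁻ []       ds _  = []
  skewBefore-⋃⁻ (c ∷ cs) ds ≻ =
    right ds (λ i j i∈c → ≻ i j (p⊆p∪q (⋃ cs) i∈c)) ∷
    skewBefore-⋃⁻ cs ds (λ i j i∈cs → ≻ i j (q⊆p∪q c (⋃ cs) i∈cs))
    where
    right : ∀ ds → SkewBefore π c (⋃ ds) → All (SkewBefore π c) ds
    right []       _ = []
    right (d ∷ ds) ≻ =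
      (λ i j i∈c j∈d → ≻ i j i∈c (p⊆p∪q (⋃ ds) j∈d)) ∷
      right ds (λ i j i∈c j∈ds → ≻ i j i∈c (q⊆p∪q d (⋃ ds) j∈ds))

  skewDecomposition-++ : ∀ {A B cs ds} → SkewBefore π A B →
    SkewDecomposition π A cs → SkewDecomposition π B ds →
    SkewDecomposition π (A ∪ B) (cs ++ ds)
  skewDecomposition-++ {cs = cs} {ds} A≻B
    record { covers = refl ; ordered = cs-ord ; indecomposable = cs-ind }
    record { covers = refl ; ordered = ds-ord ; indecomposable = ds-ind } = record
    { covers         = ⋃-++ cs ds
    ; ordered        = AllPairs.++⁺ cs-ord ds-ord (skewBefore-⋃⁻ cs ds A≻B)
    ; indecomposable = All.++⁺ cs-ind ds-ind
    }

  -- `BetweenSkewComponents` speaks only of parts of actual decompositions, so one must be exhibited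
  -- before it yields anything. The recursion is on strict inclusion.
  skewDecomposition-exists : ∀ S → ∃[ cs ] SkewDecomposition π S cs
  skewDecomposition-exists S = go S (⊂-wellFounded S)
    where
    go : ∀ S → Acc _⊂_ S → ∃[ cs ] SkewDecomposition π S cs
    go S (acc rec) with nonempty? S
    ... | no empty = [] , record
      { covers = sym (Empty-unique empty) ; ordered = [] ; indecomposable = [] }
    ... | yes nonempty with skewDecomposable? S
    ...   | no indec = S ∷ [] , record
      { covers         = ∪-identityʳ S
      ; ordered        = [] ∷ []
      ; indecomposable = (nonempty , indec) ∷ []
      }
    ...   | yes (A , B , (a , a∈A) , (b , b∈B) , refl , A≻B) =
      -- Each half is a proper subset of `A ∪ B`: the halves are disjoint, so each misses the chosen
      -- point of the other.
      let cs , A-dec = go A (rec (p⊆p∪q B , b , q⊆p∪q A B b∈B ,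
                                  λ b∈A → skewBefore-disjoint A≻B b∈A b∈B))
          ds , B-dec = go B (rec (q⊆p∪q A B , a , p⊆p∪q B a∈A ,
                                  skewBefore-disjoint A≻B a∈A))
      in cs ++ ds , skewDecomposition-++ A≻B A-dec B-dec

  -- Points in different parts always form a descent, as the earlier part lies to the left and
  -- above.
  ascent-within-part : ∀ {cs j k} → AllPairs (SkewBefore π) cs →
    j ∈ ⋃ cs → k ∈ ⋃ cs → j < k → π ⟨$⟩ʳ j < π ⟨$⟩ʳ k →
    ∃[ c ] c List.∈ cs × j ∈ c × k ∈ c
  ascent-within-part {[]} [] j∈⊥ _ _ _ = contradiction j∈⊥ ∉⊥
  ascent-within-part {c ∷ cs} {j} {k} (c≻cs ∷ ord) j∈ k∈ j<k πj<πk
    with x∈p∪q⁻ c (⋃ cs) j∈ | x∈p∪q⁻ c (⋃ cs) k∈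
  ... | inj₁ j∈c  | inj₁ k∈c  = c , here refl , j∈c , k∈c
  -- If only `j` is in the first part, the values are the wrong way round; if only `k` is, the
  -- positions are.
  ... | inj₁ j∈c  | inj₂ k∈cs =
    contradiction (proj₂ (skewBefore-⋃ cs c≻cs j k j∈c k∈cs)) (<-asym πj<πk)
  ... | inj₂ j∈cs | inj₁ k∈c  =
    contradiction (proj₁ (skewBefore-⋃ cs c≻cs k j k∈c j∈cs)) (<-asym j<k)
  ... | inj₂ j∈cs | inj₂ k∈cs =
    let d , d∈cs , j∈d , k∈d = ascent-within-part ord j∈cs k∈cs j<k πj<πk
    in d , there d∈cs , j∈d , k∈d

  -- A single component contains the whole ascent, so it would have points on both sides of `i`.
  between⇒¬within-ascent : ∀ {S i j k} → BetweenSkewComponents π S i →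
    j ∈ S → k ∈ S → π ⟨$⟩ʳ j < π ⟨$⟩ʳ k → j < i → ¬ i < k
  between⇒¬within-ascent {S} {i} {j} {k} between j∈S k∈S πj<πk j<i i<k
    with skewDecomposition-exists S
  ... | cs , dec@(record { covers = refl ; ordered = ord }) =
    let c , c∈cs , j∈c , k∈c = ascent-within-part ord j∈S k∈S (<-trans j<i i<k) πj<πk
    in between c (cs , dec , c∈cs) ((j , j∈c , j<i) , (k , k∈c , i<k))

  -- `f` selects entries of `σ` that form the pattern `τ`. Membership in `S` is supplied separately,
  -- so that an occurrence in `⊤` can shrink to one inside a cell.
  restrict : ∀ {k m} {σ : Vec ℕ m} {τ : Vec ℕ k} {S T} (f : Fin k → Fin m) →
    (∀ a b → a < b → f a < f b) →
    (∀ a b → lookup τ a ℕ.< lookup τ b ⇔ lookup σ (f a) ℕ.< lookup σ (f b)) →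
    (o : Occurrence π σ T) → (∀ a → Occurrence.point o (f a) ∈ S) →
    Occurrence π τ S
  restrict f f-mono f-iso o f-inside = record
    { point      = point ∘ f
    ; inside     = f-inside
    ; increasing = λ a b a<b → increasing (f a) (f b) (f-mono a b a<b)
    ; order-iso  = λ a b → order-iso (f a) (f b) ⇔-∘ f-iso a b
    }
    where open Occurrence o

-- The last three entries, 324, standardise to 213; all pairs of indices are checked by computation.
p213-in-p1324 : ∀ a b →
  lookup p213 a ℕ.< lookup p213 b ⇔ lookup p1324 (suc a) ℕ.< lookup p1324 (suc b)
p213-in-p1324 a b = uncurry mk⇔ (from-yes (all? λ a → all? λ b →
  let x<y = lookup p213 a <ℕ? lookup p213 b
      u<v = lookup p1324 (suc a) <ℕ? lookup p1324 (suc b)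
  in (x<y →-dec u<v) ×-dec (u<v →-dec x<y)) a b)

p132-in-p1324 : ∀ a b →
  lookup p132 a ℕ.< lookup p132 b ⇔
  lookup p1324 (inject₁ a) ℕ.< lookup p1324 (inject₁ b)
p132-in-p1324 a b = uncurry mk⇔ (from-yes (all? λ a → all? λ b →
  let x<y = lookup p132 a <ℕ? lookup p132 b
      u<v = lookup p1324 (inject₁ a) <ℕ? lookup p1324 (inject₁ b)
  in (x<y →-dec u<v) ×-dec (u<v →-dec x<y)) a b)

inject₁-mono-< : ∀ {n} (i j : Fin n) → i < j → inject₁ i < inject₁ j
inject₁-mono-< i j = subst₂ ℕ._<_ (sym (toℕ-inject₁ i)) (sym (toℕ-inject₁ j))

module _ {n : ℕ} (V : VPair n) where
  open VPair V

  upper-closed : ∀ {i j} → i ∈ upperPoints → perm ⟨$⟩ʳ i < perm ⟨$⟩ʳ j → j ∈ upperPoints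
  upper-closed {i} {j} i∈U πi<πj with j ∈? upperPoints
  ... | yes j∈U = j∈U
  ... | no  j∉U =
    contradiction (upper-above-lower i j i∈U (x∉p⇒x∈∁p j∉U)) (<-asym πi<πj)

  lower-closed : ∀ {i j} → j ∈ lowerPoints → perm ⟨$⟩ʳ i < perm ⟨$⟩ʳ j → i ∈ lowerPoints
  lower-closed j∈L πi<πj = x∉p⇒x∈∁p λ i∈U → x∈∁p⇒x∉p j∈L (upper-closed i∈U πi<πj)

  module Occurrence1324 (o : Occurrence perm p1324 ⊤) where
    open Occurrence o public

    0<1 = increasing 0F 1F (from-yes (0 <ℕ? 1))
    1<2 = increasing 1F 2F (from-yes (1 <ℕ? 2))
    2<3 = increasing 2F 3F (from-yes (2 <ℕ? 3))

    -- The numerals compared from here on are entries of `p1324`; those above are indices.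
    π₀<π₂ = Equivalence.to (order-iso 0F 2F) (from-yes (1 <ℕ? 2))
    π₂<π₁ = Equivalence.to (order-iso 2F 1F) (from-yes (2 <ℕ? 3))
    π₁<π₃ = Equivalence.to (order-iso 1F 3F) (from-yes (3 <ℕ? 4))

    -- Otherwise the larger points `point 1F` and `point 3F` are in the upper cell too, and the
    -- three form 213 there.
    2∈L : point 2F ∈ lowerPoints
    2∈L = x∉p⇒x∈∁p λ 2∈U → upper-avoids-213
      (restrict perm suc (λ _ _ → ℕ.s≤s) p213-in-p1324 o λ where
        0F → upper-closed 2∈U π₂<π₁
        1F → 2∈U
        2F → upper-closed (upper-closed 2∈U π₂<π₁) π₁<π₃)

    0∈L : point 0F ∈ lowerPoints
    0∈L = lower-closed 2∈L π₀<π₂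

    -- In the lower cell it would complete a 132 with `point 0F` and `point 2F`. Membership is
    -- decidable, so refuting the negation suffices.
    1∈U : point 1F ∈ upperPoints
    1∈U = decidable-stable (point 1F ∈? upperPoints) λ 1∉U → lower-avoids-132
      (restrict perm inject₁ inject₁-mono-< p132-in-p1324 o λ where
        0F → 0∈L
        1F → x∉p⇒x∈∁p 1∉U
        2F → 2∈L)

    3∈U : point 3F ∈ upperPoints
    3∈U = upper-closed 1∈U π₁<π₃

lemma3p1 : (n : ℕ) (V : VPair n) (connecting : Cell) →
    let open VPair V
        domino = opposite connecting
    in (∀ (i : Fin n) → NonLeaf domino i →
          BetweenSkewComponents perm (points connecting) i) →
       Avoids perm p1324 ⊤
lemma3p1 n V upper between o = between⇒¬within-ascent perm
  -- `point 0F` keeps `point 2F` from being a left-to-right minimum of the lower cell.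
  (between (point 2F)
    (2∈L , λ (_ , minimal) → minimal (point 0F , 0∈L , <-trans 0<1 1<2 , π₀<π₂)))
  1∈U 3∈U π₁<π₃ 1<2 2<3
  where open VPair V; open Occurrence1324 V o
lemma3p1 n V lower between o = between⇒¬within-ascent perm
  -- `point 3F` keeps `point 1F` from being a right-to-left maximum of the upper cell.
  (between (point 1F)
    (1∈U , λ (_ , maximal) → maximal (point 3F , 3∈U , <-trans 1<2 2<3 , π₁<π₃)))
  0∈L 2∈L π₀<π₂ 0<1 1<2
  where open VPair V; open Occurrence1324 V o
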